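{- There is an algorithm which, given positive integers $a\le b$, decides whether the Aztec rectangle $\mathcal{AR}_{a,b}$ has a cover by L-trominoes and, if it does, outputs such a cover, in time $O(b^2)$.
   Context: A cell is a unit square $[i,i+1]\times[j,j+1]$ with $i,j\in\mathbb{Z}$, labelled $(i,j)$. An L-tromino is a set of three cells equal to a $2\times 2$ block of cells with one cell removed. A cover of a region is a partition of it into L-trominoes. For positive integers $a,b$, the Aztec rectangle $\mathcal{AR}_{a,b}$ is (up to translation) the region consisting of the cells $(i,j)\in\mathbb{Z}^2$ with $0\le i+j\le 2b$ and $1\le j-i\le 2a+1$. -}

module Defs where

open import Data.Bool.Base using (if_then_else_)
open import Data.Fin.Base as Fin using (Fin)
open import Data.Integer.Base as ℤ using (ℤ; +_; 0ℤ; 1ℤ)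
open import Data.List.Base using (List; []; _∷_; [_]; _++_; concatMap)
open import Data.List.Relation.Unary.AllPairs using (AllPairs)
open import Data.List.Relation.Unary.Any using (Any)
open import Data.Maybe.Base using (Maybe; just; nothing)
open import Data.Nat.Base as ℕ using (ℕ; suc; _≡ᵇ_)
open import Data.Product.Base using (_×_; _,_; ∃-syntax)
open import Level using (0ℓ)
open import Relation.Binary.PropositionalEquality using (_≡_; _≢_)
open import Relation.Nullary.Negation using (¬_)
open import Relation.Unary using (Pred; _≐_; _⊥_)

------------------------------------------------------------------------
-- Regions and covers

Cell : Set
Cell = ℤ × ℤ

Region : Set₁
Region = Pred Cell 0ℓ

Offset : Set
Offset = Fin 2 × Fin 2

_⊹_ : Cell → Offset → Cell
(i , j) ⊹ (di , dj) = i ℤ.+ + Fin.toℕ di , j ℤ.+ + Fin.toℕ dj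

-- The 2 × 2 block with least cell `corner`, without the cell
-- `corner ⊹ missing`.  Distinct values describe distinct sets of cells.
record LTromino : Set where
  constructor tromino
  field
    corner  : Cell
    missing : Offset

cells : LTromino → Region
cells (tromino c m) x = ∃[ d ] d ≢ m × x ≡ c ⊹ d

-- L-trominoes are nonempty, so pairwise disjointness also excludes
-- repetitions in the list.  The regions considered are finite, so lists
-- account for all their partitions.
_Covers_ : List LTromino → Region → Set
ts Covers R =
  AllPairs (λ s t → cells s ⊥ cells t) ts ×
  (λ x → Any (λ t → cells t x) ts) ≐ R

HasCover : Region → Set
HasCover R = ∃[ ts ] ts Covers R

AztecRectangle : ℕ → ℕ → Region
AztecRectangle a b (i , j) =
  (0ℤ ℤ.≤ i ℤ.+ j × i ℤ.+ j ℤ.≤ + (2 ℕ.* b)) ×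
  (1ℤ ℤ.≤ j ℤ.- i × j ℤ.- i ℤ.≤ + (2 ℕ.* a ℕ.+ 1))

------------------------------------------------------------------------
-- Algorithms: programs for the random access machine of Cook and
-- Reckhow, under the uniform cost criterion, with `if` and `while` in
-- place of jumps.  Registers X₀, X₁, … hold integers; addition and
-- subtraction are the only arithmetic operations.

Reg : Set
Reg = ℕ

data Instr : Set where
  _≔_      : Reg → ℤ → Instr              -- Xᵢ ← k
  _≔_⊕_    : Reg → Reg → Reg → Instr      -- Xᵢ ← Xⱼ + Xₖ
  _≔_⊖_    : Reg → Reg → Reg → Instr      -- Xᵢ ← Xⱼ - Xₖ
  _≔*_     : Reg → Reg → Instr            -- Xᵢ ← X_{Xⱼ}
  *_≔_     : Reg → Reg → Instr            -- X_{Xᵢ} ← Xⱼ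
  print    : Reg → Instr

infixr 5 _⨾_

data Program : Set where
  skip               : Program
  instr              : Instr → Program
  _⨾_                : Program → Program → Program
  if_>0-then_else_   : Reg → Program → Program → Program
  while_>0-do_       : Reg → Program → Program

Memory : Set
Memory = Reg → ℤ

_[_↦_] : Memory → Reg → ℤ → Memory
(m [ r ↦ v ]) s = if s ≡ᵇ r then v else m s

-- ⟨ ι , m ⟩⟶⟨ m′ , out ⟩: the instruction ι turns the memory m into m′
-- and prints out.  Indirect access at a negative address is stuck.
data ⟨_,_⟩⟶⟨_,_⟩ : Instr → Memory → Memory → List ℤ → Set where
  const : ∀ {m i k} → ⟨ i ≔ k , m ⟩⟶⟨ m [ i ↦ k ] , [] ⟩
  add   : ∀ {m i j k} → ⟨ i ≔ j ⊕ k , m ⟩⟶⟨ m [ i ↦ m j ℤ.+ m k ] , [] ⟩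
  sub   : ∀ {m i j k} → ⟨ i ≔ j ⊖ k , m ⟩⟶⟨ m [ i ↦ m j ℤ.- m k ] , [] ⟩
  load  : ∀ {m i j n} → m j ≡ + n → ⟨ i ≔* j , m ⟩⟶⟨ m [ i ↦ m n ] , [] ⟩
  store : ∀ {m i j n} → m i ≡ + n → ⟨ * i ≔ j , m ⟩⟶⟨ m [ n ↦ m j ] , [] ⟩
  print : ∀ {m i} → ⟨ print i , m ⟩⟶⟨ m , [ m i ] ⟩

-- ⟨ p , m ⟩⇓⟨ m′ , out , t ⟩: started in memory m, the program p halts in
-- memory m′ after t steps, having printed out.  Every instruction and
-- every test of a register is one step.
data ⟨_,_⟩⇓⟨_,_,_⟩ : Program → Memory → Memory → List ℤ → ℕ → Set where
  skip : ∀ {m} → ⟨ skip , m ⟩⇓⟨ m , [] , 1 ⟩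

  instr : ∀ {ι m m′ out} →
    ⟨ ι , m ⟩⟶⟨ m′ , out ⟩ →
    ⟨ instr ι , m ⟩⇓⟨ m′ , out , 1 ⟩

  seq : ∀ {p q m m′ m″ out out′ t t′} →
    ⟨ p , m ⟩⇓⟨ m′ , out , t ⟩ →
    ⟨ q , m′ ⟩⇓⟨ m″ , out′ , t′ ⟩ →
    ⟨ p ⨾ q , m ⟩⇓⟨ m″ , out ++ out′ , t ℕ.+ t′ ⟩

  if-true : ∀ {r p q m m′ out t} →
    0ℤ ℤ.< m r →
    ⟨ p , m ⟩⇓⟨ m′ , out , t ⟩ →
    ⟨ if r >0-then p else q , m ⟩⇓⟨ m′ , out , suc t ⟩

  if-false : ∀ {r p q m m′ out t} →
    m r ℤ.≤ 0ℤ →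
    ⟨ q , m ⟩⇓⟨ m′ , out , t ⟩ →
    ⟨ if r >0-then p else q , m ⟩⇓⟨ m′ , out , suc t ⟩

  while-true : ∀ {r p m m′ m″ out out′ t t′} →
    0ℤ ℤ.< m r →
    ⟨ p , m ⟩⇓⟨ m′ , out , t ⟩ →
    ⟨ while r >0-do p , m′ ⟩⇓⟨ m″ , out′ , t′ ⟩ →
    ⟨ while r >0-do p , m ⟩⇓⟨ m″ , out ++ out′ , suc (t ℕ.+ t′) ⟩

  while-false : ∀ {r p m} →
    m r ℤ.≤ 0ℤ →
    ⟨ while r >0-do p , m ⟩⇓⟨ m , [] , 1 ⟩

input : ℕ → ℕ → Memory
input a b 0             = + a
input a b 1             = + b
input a b (suc (suc _)) = 0ℤ

_on_Prints_In_Steps : Program → Memory → List ℤ → ℕ → Set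
p on m Prints out In t Steps = ∃[ m′ ] ⟨ p , m ⟩⇓⟨ m′ , out , t ⟩

------------------------------------------------------------------------
-- Answers to the cover problem

Answer : Set
Answer = Maybe (List LTromino)

Correct : Region → Answer → Set
Correct R nothing   = ¬ HasCover R
Correct R (just ts) = ts Covers R

encodeTromino : LTromino → List ℤ
encodeTromino (tromino (i , j) (di , dj)) =
  i ∷ j ∷ + Fin.toℕ di ∷ + Fin.toℕ dj ∷ []

-- The leading 0 or 1 is the decision; the encoding is injective.
encode : Answer → List ℤ
encode nothing   = [ 0ℤ ]
encode (just ts) = 1ℤ ∷ concatMap encodeTromino ts

{-# OPTIONS --safe #-}

-- In the coordinates s = i + j and d = j - i an L-tromino is exactly the set of
-- cells in a 3 × 2 or a 2 × 3 box, and AR_{a,b} is the set of cells in a box of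
-- size (2b + 1) × (2a + 1).  It has (b + 1)a + b(a + 1) cells, so it can only be
-- covered if a ≡ b ≡ 0 or a ≡ b ≡ 2 modulo 3.  Conversely, for r = 2 and r = 3,
-- the (2r + 1) × (2r + 1) box is a pinwheel of 3 × 2 and 2 × 3 boxes around one
-- point (s , d) with s + d odd, which is not a cell; and it can be extended in
-- either direction by strips of width 6, which are cut into such boxes as well.
module Submission where

open import Defs
open import Data.Nat.Base using (ℕ; _*_; _^_; _≤_)
open import Data.Product.Base using (_×_; Σ-syntax)

open import Data.Bool.Base using (true; false)
open import Data.Fin.Base as Fin using (Fin; fromℕ<)
open import Data.Fin.Patterns using (0F; 1F; 2F)
import Data.Fin.Properties as Fin
open import Data.Integer.Base as ℤ using (ℤ; +_; 0ℤ; 1ℤ; +≤+; +<+)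
import Data.Integer.DivMod as ℤ
open import Data.Integer.Divisibility.Signed using (_∣_; _∣?_; divides; ∣⇒∣ᵤ)
import Data.Integer.Properties as ℤ
open import Data.Integer.Tactic.RingSolver using (solve-∀)
open import Data.List.Base using (List; []; _∷_; [_]; _++_; map; concatMap; filter;
  allFin; cartesianProduct; cartesianProductWith; upTo; length)
open import Data.List.Membership.Propositional using (_∈_; _∉_; find; lose)
open import Data.List.Membership.Propositional.Properties
open import Data.List.Membership.Propositional.Properties.WithK using (unique∧set⇒bag)
open import Data.List.Properties using (++-identityʳ; concatMap-++; length-++; length-map; length-upTo)
open import Data.List.Relation.Binary.BagAndSetEquality using (∼bag⇒↭)
open import Data.List.Relation.Binary.Permutation.Propositional.Properties using (↭-length)
open import Data.List.Relation.Unary.All as All using (All; []; _∷_)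
import Data.List.Relation.Unary.All.Properties as All
open import Data.List.Relation.Unary.AllPairs as AllPairs using (AllPairs; []; _∷_)
import Data.List.Relation.Unary.AllPairs.Properties as AllPairs
open import Data.List.Relation.Unary.Any as Any using (Any; any?)
import Data.List.Relation.Unary.Any.Properties as Any
open import Data.List.Relation.Unary.Unique.Propositional using (Unique)
import Data.List.Relation.Unary.Unique.Propositional.Properties as Unique
open import Data.Maybe.Base using (just; nothing)
open import Data.Nat.Base as ℕ using (zero; suc; _≡ᵇ_; _<_)
open import Data.Nat.DivMod using (_divMod_; result)
import Data.Nat.Divisibility as ℕ
import Data.Nat.Properties as ℕ
import Data.Nat.Tactic.RingSolver as ℕ-Solver
open import Data.Product.Base using (_,_; proj₁; proj₂; ∃-syntax)
open import Data.Product.Properties using (≡-dec)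
open import Data.Sum.Base using (_⊎_; inj₁; inj₂; [_,_]′)
open import Data.Unit.Base using (⊤; tt)
open import Function.Base using (_∘_; id)
open import Function.Bundles using (mk⇔)
open import Relation.Binary.PropositionalEquality using (_≡_; _≢_;
  refl; sym; trans; cong; cong₂; subst; subst₂; module ≡-Reasoning)
open import Relation.Nullary.Decidable using (Dec; yes; no; True; False; toWitness;
  toWitnessFalse; from-no; ¬?; _×-dec_; _⊎-dec_)
open import Relation.Nullary.Negation using (¬_; contradiction)
open import Relation.Unary using (Decidable; _≐_; _⊥_; _⊆_; _∪_)

open import Algebra.Properties.AbelianGroup ℤ.+-0-abelianGroup using (∙-cancelˡ)

-- The number 6 is chosen for three reasons. It is a multiple of 2 and of 3, so boxes of either
-- shape fit across a strip of width 6. Since 2(r + 3q) + 1 = (2r + 1) + 6q, adding strips runs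
-- through a residue class modulo 3. And it is even, so a step of 6 in `s` or `d` keeps the parity
-- of `s + d` and is a translation of cells. Hence four finite lists per class suffice, each checked
-- by evaluation: a corner, one strip piece in either direction, and a 6 × 6 tile between the
-- strips. The program contains these lists as constants and prints translated copies in nested
-- loops. The machine cannot divide, so the residues modulo 3 are found by repeated subtraction in
-- linear time; printing takes O((p + 1)(q + 1)) steps for a = r + 3p and b = r + 3q. Remainders are
-- taken in {1, 2, 3}: for r = 0 the strips would have height 1, too thin for any box.

-- Trominoes as finite lists of cells

_≟ᶜ_ : (x y : Cell) → Dec (x ≡ y)
_≟ᶜ_ = ≡-dec ℤ._≟_ ℤ._≟_

open import Data.List.Membership.DecPropositional _≟ᶜ_ using (_∈?_)

_≟ᵒ_ : (x y : Offset) → Dec (x ≡ y)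
_≟ᵒ_ = ≡-dec Fin._≟_ Fin._≟_

offsets : List Offset
offsets = cartesianProduct (allFin 2) (allFin 2)

offsetsExcept : Offset → List Offset
offsetsExcept m = filter (λ d → ¬? (d ≟ᵒ m)) offsets

cellList : LTromino → List Cell
cellList (tromino c m) = map (c ⊹_) (offsetsExcept m)

cells⇒∈ : ∀ t {x} → cells t x → x ∈ cellList t
cells⇒∈ (tromino c m) ((k , l) , d≢m , refl) =
  ∈-map⁺ (c ⊹_) (∈-filter⁺ (λ d → ¬? (d ≟ᵒ m))
    (∈-cartesianProduct⁺ (∈-allFin k) (∈-allFin l)) d≢m)

∈⇒cells : ∀ t {x} → x ∈ cellList t → cells t x
∈⇒cells (tromino c m) x∈ with ∈-map⁻ (c ⊹_) x∈
... | d , d∈ , x≡ = d , proj₂ (∈-filter⁻ (λ d → ¬? (d ≟ᵒ m)) {xs = offsets} d∈) , x≡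

-- Diagonal coordinates and boxes

x+x-injective : ∀ {x y : ℤ} → x ℤ.+ x ≡ y ℤ.+ y → x ≡ y
x+x-injective {x} {y} eq = ℤ.*-cancelˡ-≡ (+ 2) x y (trans (double x) (trans eq (sym (double y))))
  where
  double : ∀ z → + 2 ℤ.* z ≡ z ℤ.+ z
  double = solve-∀

-- The two diagonals determine `2i` and `2j`, and doubling is injective; this compares cells without
-- any halving.
diagonals-injective : ∀ {i j i′ j′ : ℤ} → i ℤ.+ j ≡ i′ ℤ.+ j′ → j ℤ.- i ≡ j′ ℤ.- i′ →
                      (i , j) ≡ (i′ , j′)
diagonals-injective {i} {j} {i′} {j′} σ δ = cong₂ _,_
  (x+x-injective (trans (i+i i j) (trans (cong₂ ℤ._-_ σ δ) (sym (i+i i′ j′)))))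
  (x+x-injective (trans (j+j i j) (trans (cong₂ ℤ._+_ σ δ) (sym (j+j i′ j′)))))
  where
  i+i : ∀ i j → i ℤ.+ i ≡ (i ℤ.+ j) ℤ.- (j ℤ.- i)
  i+i = solve-∀
  j+j : ∀ i j → j ℤ.+ j ≡ (i ℤ.+ j) ℤ.+ (j ℤ.- i)
  j+j = solve-∀

-- Half-open, so that consecutive intervals abut without overlap and width 0 is empty.
Interval : ℤ → ℕ → ℤ → Set
Interval s w x = s ℤ.≤ x × x ℤ.< s ℤ.+ + w

interval? : ∀ s w x → Dec (Interval s w x)
interval? s w x = (s ℤ.≤? x) ×-dec (x ℤ.<? (s ℤ.+ + w))

interval-index : ∀ {s w x} → Interval s w x → ∃[ f ] x ≡ s ℤ.+ + Fin.toℕ {w} f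
interval-index {s} {w} {x} (s≤x , x<s+w) = fromℕ< n<w , (begin
  x                              ≡⟨ split x s ⟩
  s ℤ.+ (x ℤ.- s)                ≡⟨ cong (ℤ._+_ s) n≡ ⟨
  s ℤ.+ + n                      ≡⟨ cong (λ k → s ℤ.+ + k) (Fin.toℕ-fromℕ< n<w) ⟨
  s ℤ.+ + Fin.toℕ (fromℕ< n<w)   ∎)
  where
  open ≡-Reasoning
  split : ∀ x s → x ≡ s ℤ.+ (x ℤ.- s)
  split = solve-∀
  cancel : ∀ s w → (s ℤ.+ w) ℤ.- s ≡ w
  cancel = solve-∀
  n : ℕ
  n = ℤ.∣ x ℤ.- s ∣
  n≡ : + n ≡ x ℤ.- s
  n≡ = ℤ.0≤i⇒+∣i∣≡i (ℤ.i≤j⇒0≤j-i s≤x)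
  n<w : n < w
  n<w = ℤ.drop‿+<+ (subst₂ ℤ._<_ (sym n≡) (cancel s (+ w)) (ℤ.+-monoˡ-< (ℤ.- s) x<s+w))

interval-shift : ∀ {s w x} k → Interval s w x → Interval (s ℤ.+ k) w (x ℤ.+ k)
interval-shift {s} {w} {x} k (s≤x , x<s+w) =
  ℤ.+-monoˡ-≤ k s≤x ,
  subst (x ℤ.+ k ℤ.<_) (swap s (+ w) k) (ℤ.+-monoˡ-< k x<s+w)
  where
  swap : ∀ s w k → (s ℤ.+ w) ℤ.+ k ≡ (s ℤ.+ k) ℤ.+ w
  swap = solve-∀

interval-unshift : ∀ {s w x} k → Interval (s ℤ.+ k) w (x ℤ.+ k) → Interval s w x
interval-unshift {s} {w} {x} k p =
  subst₂ (λ s x → Interval s w x) (cancel s k) (cancel x k) (interval-shift (ℤ.- k) p)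
  where
  cancel : ∀ s k → (s ℤ.+ k) ℤ.+ ℤ.- k ≡ s
  cancel = solve-∀

interval-empty : ∀ {s x} → ¬ Interval s 0 x
interval-empty {s} {x} (s≤x , x<s+0) = ℤ.<⇒≱ (subst (x ℤ.<_) (ℤ.+-identityʳ s) x<s+0) s≤x

interval-assoc : ∀ s m n → (s ℤ.+ + m) ℤ.+ + n ≡ s ℤ.+ + (m ℕ.+ n)
interval-assoc s m n = trans (ℤ.+-assoc s (+ m) (+ n)) (cong (ℤ._+_ s) (sym (ℤ.pos-+ m n)))

interval-++ : ∀ s m n → Interval s m ∪ Interval (s ℤ.+ + m) n ≐ Interval s (m ℕ.+ n)
interval-++ s m n = [ left , right ]′ , split
  where
  left : Interval s m ⊆ Interval s (m ℕ.+ n)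
  left (s≤x , x<) = s≤x , ℤ.<-≤-trans x< (subst (s ℤ.+ + m ℤ.≤_) (interval-assoc s m n) (ℤ.i≤i+j _ (+ n)))
  right : Interval (s ℤ.+ + m) n ⊆ Interval s (m ℕ.+ n)
  right {x} (≤x , x<) = ℤ.≤-trans (ℤ.i≤i+j s (+ m)) ≤x , subst (x ℤ.<_) (interval-assoc s m n) x<
  split : Interval s (m ℕ.+ n) ⊆ Interval s m ∪ Interval (s ℤ.+ + m) n
  split {x} (s≤x , x<) with x ℤ.<? (s ℤ.+ + m)
  ... | yes x<s+m = inj₁ (s≤x , x<s+m)
  ... | no  x≮s+m = inj₂ (ℤ.≮⇒≥ x≮s+m , subst (x ℤ.<_) (sym (interval-assoc s m n)) x<)

interval-⊥ : ∀ {s m n x} → Interval s m x → ¬ Interval (s ℤ.+ + m) n x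
interval-⊥ (_ , x<) (≤x , _) = ℤ.<⇒≱ x< ≤x

Box : ℤ → ℤ → ℕ → ℕ → Region
Box s d w h (i , j) = Interval s w (i ℤ.+ j) × Interval d h (j ℤ.- i)

box? : ∀ s d w h → Decidable (Box s d w h)
box? s d w h (i , j) = interval? s w (i ℤ.+ j) ×-dec interval? d h (j ℤ.- i)

OnDiagonals : ℤ → ℤ → Cell → Set
OnDiagonals σ δ (i , j) = i ℤ.+ j ≡ σ × j ℤ.- i ≡ δ

onDiagonals? : ∀ σ δ → Decidable (OnDiagonals σ δ)
onDiagonals? σ δ (i , j) = (i ℤ.+ j ℤ.≟ σ) ×-dec (j ℤ.- i ℤ.≟ δ)

-- The sum is `2j`. By this parity obstruction half of the points near any place, pinwheel centres
-- included, carry no cell.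
onDiagonals⇒even : ∀ {σ δ} c → OnDiagonals σ δ c → + 2 ∣ σ ℤ.+ δ
onDiagonals⇒even (i , j) (refl , refl) = divides j (double i j)
  where
  double : ∀ i j → (i ℤ.+ j) ℤ.+ (j ℤ.- i) ≡ j ℤ.* + 2
  double = solve-∀

onDiagonals-unique : ∀ {σ δ} c c′ → OnDiagonals σ δ c → OnDiagonals σ δ c′ → c ≡ c′
onDiagonals-unique c c′ (σ , δ) (σ′ , δ′) = diagonals-injective (trans σ (sym σ′)) (trans δ (sym δ′))

-- Decidable certificates for covers of a fixed box

-- A cover in terms of finite data. Completeness ranges over all points of the box in diagonal
-- coordinates: each is hit by a tromino or has odd sum and is no cell.
Certificate : List LTromino → ℤ → ℤ → ℕ → ℕ → Set
Certificate ts s d w h =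
  AllPairs (λ t u → All (_∉ cellList u) (cellList t)) ts ×
  All (λ t → All (Box s d w h) (cellList t)) ts ×
  (∀ (f : Fin w) (g : Fin h) → let σ = s ℤ.+ + Fin.toℕ f; δ = d ℤ.+ + Fin.toℕ g in
    Any (λ t → Any (OnDiagonals σ δ) (cellList t)) ts ⊎ ¬ (+ 2 ∣ σ ℤ.+ δ))

certificate? : ∀ ts s d w h → Dec (Certificate ts s d w h)
certificate? ts s d w h =
  AllPairs.allPairs? (λ t u → All.all? (λ x → ¬? (x ∈? cellList u)) (cellList t)) ts ×-dec
  All.all? (λ t → All.all? (box? s d w h) (cellList t)) ts ×-dec
  Fin.all? λ f → Fin.all? λ g →
    any? (λ t → any? (onDiagonals? _ _) (cellList t)) ts ⊎-dec ¬? (+ 2 ∣? _)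

certificate⇒covers : ∀ {ts s d w h} → Certificate ts s d w h → ts Covers Box s d w h
certificate⇒covers {ts} {s} {d} {w} {h} (disjoint , inside , complete) =
  AllPairs.map (λ {t} {u} t∉u {x} (x∈t , x∈u) → All.lookup t∉u (cells⇒∈ t x∈t) (cells⇒∈ u x∈u)) disjoint ,
  sound , covered
  where
  sound : ∀ {x} → Any (λ t → cells t x) ts → Box s d w h x
  sound x∈ = let ⊆box , x∈t = All.lookupAny inside x∈ in
    All.lookup ⊆box (cells⇒∈ (Any.lookup x∈) x∈t)
  covered : ∀ {x} → Box s d w h x → Any (λ t → cells t x) ts
  covered {x} (σ∈ , δ∈) with interval-index σ∈ | interval-index δ∈
  ... | f , σ≡ | g , δ≡ with complete f g
  ...   | inj₁ hit  = Any.map (λ {t} c∈t → let c , c∈ , on = find c∈t in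
                        subst (cells t) (onDiagonals-unique c x on (σ≡ , δ≡)) (∈⇒cells t c∈)) hit
  ...   | inj₂ odd = contradiction (onDiagonals⇒even x (σ≡ , δ≡)) odd

-- Unions, translates and periodic repetition of covers

covers-++ : ∀ {ts us R S} → R ⊥ S → ts Covers R → us Covers S → (ts ++ us) Covers (R ∪ S)
covers-++ {ts} {us} R⊥S (ts⊥ , ts⊆R , R⊆ts) (us⊥ , us⊆S , S⊆us) =
  AllPairs.++⁺ ts⊥ us⊥
    (All.tabulate λ t∈ts → All.tabulate λ u∈us {x} (x∈t , x∈u) →
      R⊥S (ts⊆R (lose t∈ts x∈t) , us⊆S (lose u∈us x∈u))) ,
  (λ x∈ → [ inj₁ ∘ ts⊆R , inj₂ ∘ us⊆S ]′ (Any.++⁻ ts x∈)) ,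
  [ Any.++⁺ˡ ∘ R⊆ts , Any.++⁺ʳ ts ∘ S⊆us ]′

covers-resp-≐ : ∀ {ts R S} → R ≐ S → ts Covers R → ts Covers S
covers-resp-≐ (R⊆S , S⊆R) (ts⊥ , ts⊆R , R⊆ts) = ts⊥ , R⊆S ∘ ts⊆R , R⊆ts ∘ S⊆R

shift : Cell → LTromino → LTromino
shift (k , l) (tromino (i , j) m) = tromino (k ℤ.+ i , l ℤ.+ j) m

-- Regions are predicates, so `R ∘ unshift v` is the translate of `R` by `v`.
unshift : Cell → Cell → Cell
unshift (k , l) (i , j) = i ℤ.- k , j ℤ.- l

cells-shift : ∀ v t → cells (shift v t) ≐ cells t ∘ unshift v
cells-shift (k , l) (tromino (i , j) m) =
  (λ { (d , d≢m , refl) → d , d≢m , cong₂ _,_ (forth k i _) (forth l j _) }) ,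
  (λ { (d , d≢m , eq) → d , d≢m , cong₂ _,_ (back k i (cong proj₁ eq)) (back l j (cong proj₂ eq)) })
  where
  forth : ∀ k i d → ((k ℤ.+ i) ℤ.+ d) ℤ.- k ≡ i ℤ.+ d
  forth = solve-∀
  restore : ∀ k x → x ≡ k ℤ.+ (x ℤ.- k)
  restore = solve-∀
  back : ∀ k i {x d} → x ℤ.- k ≡ i ℤ.+ d → x ≡ (k ℤ.+ i) ℤ.+ d
  back k i {x} {d} eq = trans (restore k x) (trans (cong (ℤ._+_ k) eq) (sym (ℤ.+-assoc k i d)))

covers-shift : ∀ {ts R} v → ts Covers R → map (shift v) ts Covers (R ∘ unshift v)
covers-shift {ts} v (ts⊥ , ts⊆R , R⊆ts) =
  AllPairs.map⁺ (AllPairs.map (λ {t} {u} t⊥u {x} (x∈t , x∈u) →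
    t⊥u (proj₁ (cells-shift v t) x∈t , proj₁ (cells-shift v u) x∈u)) ts⊥) ,
  (λ x∈ → ts⊆R (Any.map (λ {t} → proj₁ (cells-shift v t)) (Any.map⁻ x∈))) ,
  (λ x∈ → Any.map⁺ (Any.map (λ {t} → proj₂ (cells-shift v t)) (R⊆ts x∈)))

-- The translations that add 6 to one of `i + j`, `j - i` and fix the other.
_⟶east _⟶north : Cell → Cell
(i , j) ⟶east  = i ℤ.+ + 3 , j ℤ.+ + 3
(i , j) ⟶north = i ℤ.- + 3 , j ℤ.+ + 3

box-east : ∀ s d w h v → Box s d w h ∘ unshift (v ⟶east) ≐ Box (s ℤ.+ + 6) d w h ∘ unshift v
box-east s d w h (k , l) =
  (λ { {i , j} (σ∈ , δ∈) → subst (Interval _ w) (σ i j k l) (interval-shift (+ 6) σ∈) ,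
                          subst (Interval d h) (δ i j k l) δ∈ }) ,
  (λ { {i , j} (σ∈ , δ∈) → interval-unshift (+ 6) (subst (Interval _ w) (sym (σ i j k l)) σ∈) ,
                          subst (Interval d h) (sym (δ i j k l)) δ∈ })
  where
  σ : ∀ i j k l → ((i ℤ.- (k ℤ.+ + 3)) ℤ.+ (j ℤ.- (l ℤ.+ + 3))) ℤ.+ + 6 ≡ (i ℤ.- k) ℤ.+ (j ℤ.- l)
  σ = solve-∀
  δ : ∀ i j k l → (j ℤ.- (l ℤ.+ + 3)) ℤ.- (i ℤ.- (k ℤ.+ + 3)) ≡ (j ℤ.- l) ℤ.- (i ℤ.- k)
  δ = solve-∀

box-north : ∀ s d w h v → Box s d w h ∘ unshift (v ⟶north) ≐ Box s (d ℤ.+ + 6) w h ∘ unshift v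
box-north s d w h (k , l) =
  (λ { {i , j} (σ∈ , δ∈) → subst (Interval s w) (σ i j k l) σ∈ ,
                          subst (Interval _ h) (δ i j k l) (interval-shift (+ 6) δ∈) }) ,
  (λ { {i , j} (σ∈ , δ∈) → subst (Interval s w) (sym (σ i j k l)) σ∈ ,
                          interval-unshift (+ 6) (subst (Interval _ h) (sym (δ i j k l)) δ∈) })
  where
  σ : ∀ i j k l → (i ℤ.- (k ℤ.- + 3)) ℤ.+ (j ℤ.- (l ℤ.+ + 3)) ≡ (i ℤ.- k) ℤ.+ (j ℤ.- l)
  σ = solve-∀
  δ : ∀ i j k l → ((j ℤ.- (l ℤ.+ + 3)) ℤ.- (i ℤ.- (k ℤ.- + 3))) ℤ.+ + 6 ≡ (j ℤ.- l) ℤ.- (i ℤ.- k)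
  δ = solve-∀

covers-beside : ∀ {ts us s d w w′ h} v →
  ts Covers (Box s d w h ∘ unshift v) → us Covers (Box (s ℤ.+ + w) d w′ h ∘ unshift v) →
  (ts ++ us) Covers (Box s d (w ℕ.+ w′) h ∘ unshift v)
covers-beside {s = s} {w = w} {w′} v cs ds = covers-resp-≐
  ([ (λ (σ∈ , δ∈) → proj₁ (interval-++ s w w′) (inj₁ σ∈) , δ∈) ,
     (λ (σ∈ , δ∈) → proj₁ (interval-++ s w w′) (inj₂ σ∈) , δ∈) ]′ ,
   (λ (σ∈ , δ∈) → [ (λ p → inj₁ (p , δ∈)) , (λ p → inj₂ (p , δ∈)) ]′ (proj₂ (interval-++ s w w′) σ∈)))
  (covers-++ (λ (p , q) → interval-⊥ (proj₁ p) (proj₁ q)) cs ds)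

covers-above : ∀ {ts us s d w h h′} v →
  ts Covers (Box s d w h ∘ unshift v) → us Covers (Box s (d ℤ.+ + h) w h′ ∘ unshift v) →
  (ts ++ us) Covers (Box s d w (h ℕ.+ h′) ∘ unshift v)
covers-above {d = d} {h = h} {h′} v cs ds = covers-resp-≐
  ([ (λ (σ∈ , δ∈) → σ∈ , proj₁ (interval-++ d h h′) (inj₁ δ∈)) ,
     (λ (σ∈ , δ∈) → σ∈ , proj₁ (interval-++ d h h′) (inj₂ δ∈)) ]′ ,
   (λ (σ∈ , δ∈) → [ (λ p → inj₁ (σ∈ , p)) , (λ p → inj₂ (σ∈ , p)) ]′ (proj₂ (interval-++ d h h′) δ∈)))
  (covers-++ (λ (p , q) → interval-⊥ (proj₂ p) (proj₂ q)) cs ds)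

covers-empty : ∀ {R} → (∀ {x} → ¬ R x) → [] Covers R
covers-empty empty = [] , (λ ()) , (λ x∈ → contradiction x∈ empty)

-- Carrying the current translation along mirrors the printing loops, so the list has the order of
-- the output.
repeat : (Cell → List LTromino) → (Cell → Cell) → ℕ → Cell → List LTromino
repeat f step zero    v = []
repeat f step (suc n) v = f v ++ repeat f step n (step v)

repeat-east-covers : ∀ {f s d h} → (∀ v → f v Covers (Box s d 6 h ∘ unshift v)) →
                     ∀ n v → repeat f _⟶east n v Covers (Box s d (n * 6) h ∘ unshift v)
repeat-east-covers f-covers zero    v = covers-empty (interval-empty ∘ proj₁)
repeat-east-covers f-covers (suc n) v = covers-beside v (f-covers v)
  (covers-resp-≐ (box-east _ _ _ _ v) (repeat-east-covers f-covers n (v ⟶east)))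

repeat-north-covers : ∀ {f s d w} → (∀ v → f v Covers (Box s d w 6 ∘ unshift v)) →
                      ∀ n v → repeat f _⟶north n v Covers (Box s d w (n * 6) ∘ unshift v)
repeat-north-covers f-covers zero    v = covers-empty (interval-empty ∘ proj₂)
repeat-north-covers f-covers (suc n) v = covers-above v (f-covers v)
  (covers-resp-≐ (box-north _ _ _ _ v) (repeat-north-covers f-covers n (v ⟶north)))

row : List LTromino → List LTromino → ℕ → Cell → List LTromino
row first rest q v = map (shift v) first ++ repeat (λ v → map (shift v) rest) _⟶east q v

row-covers : ∀ {first rest s d w h} →
  first Covers Box s d w h → rest Covers Box (s ℤ.+ + w) d 6 h →
  ∀ q v → row first rest q v Covers (Box s d (w ℕ.+ q * 6) h ∘ unshift v)
row-covers first-covers rest-covers q v = covers-beside v (covers-shift v first-covers)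
  (repeat-east-covers (λ v → covers-shift v rest-covers) q v)

-- Explicit pieces for the two solvable residue classes

-- The corner of the 2 × 2 block whose cell with the least i + j lies on the
-- diagonals i + j = s and j - i = d.
block : ℤ → ℤ → Cell
block s d = (s ℤ.- d) ℤ./ + 2 , (s ℤ.+ d) ℤ./ + 2

-- The tromino filling the 3 × 2 or 2 × 3 box with least diagonals `s` and `d`. The parity of
-- `s + d` decides which points of the box are cells, and with it which cell of the block sticks out
-- and is removed.
horizontal vertical : ℤ → ℤ → LTromino
horizontal s d with + 2 ∣? (s ℤ.+ d)
... | yes _ = tromino (block s d)             (Fin.suc Fin.zero , Fin.zero)
... | no  _ = tromino (block s (d ℤ.+ 1ℤ))    (Fin.zero , Fin.suc Fin.zero)
vertical s d with + 2 ∣? (s ℤ.+ d)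
... | yes _ = tromino (block (s ℤ.- 1ℤ) (d ℤ.+ 1ℤ)) (Fin.zero , Fin.zero)
... | no  _ = tromino (block s (d ℤ.+ 1ℤ))    (Fin.suc Fin.zero , Fin.suc Fin.zero)

horizontals verticals : ℤ → ℤ → ℕ → ℕ → List LTromino
horizontals s d m n = cartesianProductWith
  (λ k l → horizontal (s ℤ.+ + (3 * k)) (d ℤ.+ + (2 * l))) (upTo m) (upTo n)
verticals s d m n = cartesianProductWith
  (λ k l → vertical (s ℤ.+ + (2 * k)) (d ℤ.+ + (3 * l))) (upTo m) (upTo n)

-- All four pieces are given in their final position for the first copy, so every translation starts
-- from zero.
record Scheme : Set where
  field
    r  : ℕ
    corner east north tile : List LTromino
    corner-covers : corner Covers Box 0ℤ 1ℤ (2 * r ℕ.+ 1) (2 * r ℕ.+ 1)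
    east-covers   : east   Covers Box (+ (2 * r ℕ.+ 1)) 1ℤ 6 (2 * r ℕ.+ 1)
    north-covers  : north  Covers Box 0ℤ (1ℤ ℤ.+ + (2 * r ℕ.+ 1)) (2 * r ℕ.+ 1) 6
    tile-covers   : tile   Covers Box (+ (2 * r ℕ.+ 1)) (1ℤ ℤ.+ + (2 * r ℕ.+ 1)) 6 6

byCertificate : ∀ {ts s d w h} → {True (certificate? ts s d w h)} → ts Covers Box s d w h
byCertificate {_} {_} {_} {_} {_} {c} = certificate⇒covers (toWitness c)

scheme₂ scheme₃ : Scheme
scheme₂ = record
  { r = 2
  -- Four single boxes around the point (2 , 3), each side being 3 + 2.
  ; corner = horizontals (+ 0) (+ 1) 1 1 ++ verticals (+ 3) (+ 1) 1 1 ++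
             horizontals (+ 2) (+ 4) 1 1 ++ verticals (+ 0) (+ 3) 1 1
  -- The height 5 is split as 3 + 2, and the length 6 as three times 2 and as two times 3.
  ; east   = verticals (+ 5) (+ 1) 3 1 ++ horizontals (+ 5) (+ 4) 2 1
  ; north  = horizontals (+ 0) (+ 6) 1 3 ++ verticals (+ 3) (+ 6) 1 2
  ; tile   = horizontals (+ 5) (+ 6) 2 3
  ; corner-covers = byCertificate
  ; east-covers = byCertificate
  ; north-covers = byCertificate
  ; tile-covers = byCertificate
  }
scheme₃ = record
  { r = 3
  -- Pairs of boxes form arms of size 4 × 3 and 3 × 4 around the point (3 , 4).
  ; corner = verticals (+ 0) (+ 1) 2 1 ++ horizontals (+ 4) (+ 1) 1 2 ++
             verticals (+ 3) (+ 5) 2 1 ++ horizontals (+ 0) (+ 4) 1 2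
  ; east   = verticals (+ 7) (+ 1) 3 1 ++ horizontals (+ 7) (+ 4) 2 2
  ; north  = horizontals (+ 0) (+ 8) 1 3 ++ verticals (+ 3) (+ 8) 2 2
  ; tile   = horizontals (+ 7) (+ 8) 2 3
  ; corner-covers = byCertificate
  ; east-covers = byCertificate
  ; north-covers = byCertificate
  ; tile-covers = byCertificate
  }

-- Counting cells: the obstruction modulo 3

⊹-injective : ∀ c {d e} → c ⊹ d ≡ c ⊹ e → d ≡ e
⊹-injective (i , j) eq = cong₂ _,_ (coordinate i (cong proj₁ eq)) (coordinate j (cong proj₂ eq))
  where
  coordinate : ∀ i {k l : Fin 2} → i ℤ.+ + Fin.toℕ k ≡ i ℤ.+ + Fin.toℕ l → k ≡ l
  coordinate i = Fin.toℕ-injective ∘ ℤ.+-injective ∘ ∙-cancelˡ i _ _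

cellList-unique : ∀ t → Unique (cellList t)
cellList-unique (tromino c m) = Unique.map⁺ (⊹-injective c)
  (Unique.filter⁺ (λ d → ¬? (d ≟ᵒ m)) (Unique.cartesianProduct⁺ (Unique.allFin⁺ 2) (Unique.allFin⁺ 2)))

length-cellList : ∀ t → length (cellList t) ≡ 3
length-cellList (tromino c (Fin.zero          , Fin.zero))         = refl
length-cellList (tromino c (Fin.zero          , Fin.suc Fin.zero)) = refl
length-cellList (tromino c (Fin.suc Fin.zero , Fin.zero))          = refl
length-cellList (tromino c (Fin.suc Fin.zero , Fin.suc Fin.zero))  = refl

length-concatMap : ∀ {A B : Set} {f : A → List B} {k} → (∀ x → length (f x) ≡ k) →
                   ∀ xs → length (concatMap f xs) ≡ length xs * k
length-concatMap f-length []       = refl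
length-concatMap {f = f} f-length (x ∷ xs) = trans (length-++ (f x))
  (cong₂ ℕ._+_ (f-length x) (length-concatMap f-length xs))

length-cartesianProductWith : ∀ {A B C : Set} (f : A → B → C) xs ys →
  length (cartesianProductWith f xs ys) ≡ length xs * length ys
length-cartesianProductWith f []       ys = refl
length-cartesianProductWith f (x ∷ xs) ys = trans (length-++ (map (f x) ys))
  (cong₂ ℕ._+_ (length-map (f x) ys) (length-cartesianProductWith f xs ys))

-- Disjointness makes the concatenated cell lists free of repetitions; having the same members as
-- `xs`, they form a permutation of it.
covers-length : ∀ {ts R xs} → ts Covers R → Unique xs → (λ x → x ∈ xs) ≐ R →
                length ts * 3 ≡ length xs
covers-length {ts} {xs = xs} (ts⊥ , ts⊆R , R⊆ts) unique (xs⊆R , R⊆xs) = trans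
  (sym (length-concatMap length-cellList ts))
  (↭-length (∼bag⇒↭ (unique∧set⇒bag cells-unique unique
    (mk⇔ (R⊆xs ∘ ts⊆R ∘ Any.map (λ {t} → ∈⇒cells t) ∘ ∈-concatMap⁻ cellList)
         (∈-concatMap⁺ cellList ∘ Any.map (λ {t} → cells⇒∈ t) ∘ R⊆ts ∘ xs⊆R)))))
  where
  cells-unique : Unique (concatMap cellList ts)
  cells-unique = Unique.concat⁺ (All.map⁺ (All.tabulate λ {t} _ → cellList-unique t))
    (AllPairs.map⁺ (AllPairs.map (λ {t} {u} t⊥u {x} (x∈t , x∈u) →
      t⊥u (∈⇒cells t x∈t , ∈⇒cells u x∈u)) ts⊥))

-- The cells on the diagonals `(2u , 2(v + 1))` and `(2u + 1 , 2v + 1)`: both coordinates of a cell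
-- have the same parity. The `suc` skips `j - i = 0`, which lies outside the rectangle.
evenCell oddCell : ℕ → ℕ → Cell
evenCell u v = + u ℤ.- + suc v , + u ℤ.+ + suc v
oddCell  u v = + u ℤ.- + v , + u ℤ.+ + v ℤ.+ 1ℤ

σ-evenCell : ∀ (u v : ℤ) → (u ℤ.- v) ℤ.+ (u ℤ.+ v) ≡ u ℤ.+ u
σ-evenCell = solve-∀

δ-evenCell : ∀ (u v : ℤ) → (u ℤ.+ v) ℤ.- (u ℤ.- v) ≡ v ℤ.+ v
δ-evenCell = solve-∀

σ-oddCell : ∀ (u v : ℤ) → (u ℤ.- v) ℤ.+ (u ℤ.+ v ℤ.+ 1ℤ) ≡ 1ℤ ℤ.+ (u ℤ.+ u)
σ-oddCell = solve-∀

δ-oddCell : ∀ (u v : ℤ) → (u ℤ.+ v ℤ.+ 1ℤ) ℤ.- (u ℤ.- v) ≡ 1ℤ ℤ.+ (v ℤ.+ v)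
δ-oddCell = solve-∀

diagonals-cong : ∀ {i j i′ j′ : ℤ} → (i , j) ≡ (i′ , j′) → i ℤ.+ j ≡ i′ ℤ.+ j′ × j ℤ.- i ≡ j′ ℤ.- i′
diagonals-cong refl = refl , refl

evenCell-injective : ∀ {u u′ v v′} → evenCell u v ≡ evenCell u′ v′ → u ≡ u′ × v ≡ v′
evenCell-injective {u} {u′} {v} {v′} eq = let σ , δ = diagonals-cong eq in
  ℤ.+-injective (x+x-injective
    (trans (sym (σ-evenCell (+ u) (+ suc v))) (trans σ (σ-evenCell (+ u′) (+ suc v′))))) ,
  ℕ.suc-injective (ℤ.+-injective (x+x-injective
    (trans (sym (δ-evenCell (+ u) (+ suc v))) (trans δ (δ-evenCell (+ u′) (+ suc v′))))))

oddCell-injective : ∀ {u u′ v v′} → oddCell u v ≡ oddCell u′ v′ → u ≡ u′ × v ≡ v′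
oddCell-injective {u} {u′} {v} {v′} eq = let σ , δ = diagonals-cong eq in
  cancel (trans (sym (σ-oddCell (+ u) (+ v))) (trans σ (σ-oddCell (+ u′) (+ v′)))) ,
  cancel (trans (sym (δ-oddCell (+ u) (+ v))) (trans δ (δ-oddCell (+ u′) (+ v′))))
  where
  cancel : ∀ {m n} → 1ℤ ℤ.+ (+ m ℤ.+ + m) ≡ 1ℤ ℤ.+ (+ n ℤ.+ + n) → m ≡ n
  cancel eq = ℤ.+-injective (x+x-injective (∙-cancelˡ 1ℤ _ _ eq))

even≢odd : ∀ m n → m ℕ.+ m ≢ suc (n ℕ.+ n)
even≢odd (suc m) n eq = even≢odd n m (sym (ℕ.suc-injective (trans (cong suc (sym (ℕ.+-suc m m))) eq)))

evenCell≢oddCell : ∀ u v u′ v′ → evenCell u v ≢ oddCell u′ v′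
evenCell≢oddCell u v u′ v′ eq = even≢odd u u′ (ℤ.+-injective
  (trans (sym (σ-evenCell (+ u) (+ suc v))) (trans (proj₁ (diagonals-cong eq)) (σ-oddCell (+ u′) (+ v′)))))

aztecCells : ℕ → ℕ → List Cell
aztecCells a b =
  cartesianProductWith evenCell (upTo (suc b)) (upTo a) ++
  cartesianProductWith oddCell (upTo b) (upTo (suc a))

aztecCells-unique : ∀ a b → Unique (aztecCells a b)
aztecCells-unique a b = Unique.++⁺
  (Unique.cartesianProductWith⁺ evenCell evenCell-injective (Unique.upTo⁺ (suc b)) (Unique.upTo⁺ a))
  (Unique.cartesianProductWith⁺ oddCell oddCell-injective (Unique.upTo⁺ b) (Unique.upTo⁺ (suc a)))
  λ (x∈ , x∈′) →
    let u  , v  , _ , _ , x≡  = ∈-cartesianProductWith⁻ evenCell (upTo (suc b)) (upTo a) x∈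
        u′ , v′ , _ , _ , x≡′ = ∈-cartesianProductWith⁻ oddCell (upTo b) (upTo (suc a)) x∈′
    in evenCell≢oddCell u v u′ v′ (trans (sym x≡) x≡′)

length-aztecCells : ∀ a b → length (aztecCells a b) ≡ suc b * a ℕ.+ b * suc a
length-aztecCells a b = trans (length-++ (cartesianProductWith evenCell (upTo (suc b)) (upTo a)))
  (cong₂ ℕ._+_ (count evenCell (suc b) a) (count oddCell b (suc a)))
  where
  count : ∀ (f : ℕ → ℕ → Cell) m n → length (cartesianProductWith f (upTo m) (upTo n)) ≡ m * n
  count f m n = trans (length-cartesianProductWith f (upTo m) (upTo n))
    (cong₂ ℕ._*_ (length-upTo m) (length-upTo n))

parity : ∀ n → (∃[ k ] n ≡ k ℕ.+ k) ⊎ (∃[ k ] n ≡ suc (k ℕ.+ k))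
parity zero = inj₁ (0 , refl)
parity (suc n) with parity n
... | inj₁ (k , refl) = inj₂ (k , refl)
... | inj₂ (k , refl) = inj₁ (suc k , cong suc (sym (ℕ.+-suc k k)))

n+n≡2*n : ∀ n → n ℕ.+ n ≡ 2 * n
n+n≡2*n = ℕ-Solver.solve-∀

n+n≤2*m⇒n≤m : ∀ {n m} → n ℕ.+ n ≤ 2 * m → n ≤ m
n+n≤2*m⇒n≤m {n} {m} le = ℕ.*-cancelˡ-≤ 2 (subst (_≤ 2 * m) (n+n≡2*n n) le)

n+n<2*m⇒n<m : ∀ {n m} → n ℕ.+ n < 2 * m → n < m
n+n<2*m⇒n<m {n} {m} lt = ℕ.*-cancelˡ-< 2 n m (subst (_< 2 * m) (n+n≡2*n n) lt)

n≤m⇒n+n≤2*m : ∀ {n m} → n ≤ m → n ℕ.+ n ≤ 2 * m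
n≤m⇒n+n≤2*m {n} {m} le = subst (_≤ 2 * m) (sym (n+n≡2*n n)) (ℕ.*-monoʳ-≤ 2 le)

n<m⇒n+n<2*m : ∀ {n m} → n < m → n ℕ.+ n < 2 * m
n<m⇒n+n<2*m {n} {m} lt = subst (_< 2 * m) (sym (n+n≡2*n n)) (ℕ.*-monoʳ-< 2 lt)

n+n≤1+2*m⇒n≤m : ∀ {n m} → n ℕ.+ n ≤ 2 * m ℕ.+ 1 → n ≤ m
n+n≤1+2*m⇒n≤m {n} {m} le = n+n≤2*m⇒n≤m (ℕ.s≤s⁻¹ (ℕ.≤∧≢⇒<
  (subst (n ℕ.+ n ℕ.≤_) (ℕ.+-comm _ 1) le)
  λ eq → even≢odd n m (trans eq (cong suc (sym (n+n≡2*n m))))))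

∈-aztecCells-even : ∀ x u v {a b} → OnDiagonals (+ (u ℕ.+ u)) (+ (suc v ℕ.+ suc v)) x →
                    u ≤ b → suc v ≤ a → x ∈ aztecCells a b
∈-aztecCells-even x u v {a} {b} on u≤b v<a = subst (_∈ aztecCells a b)
  (onDiagonals-unique (evenCell u v) x (σ-evenCell (+ u) (+ suc v) , δ-evenCell (+ u) (+ suc v)) on)
  (∈-++⁺ˡ (∈-cartesianProductWith⁺ evenCell {upTo (suc b)} (∈-upTo⁺ (ℕ.s≤s u≤b)) (∈-upTo⁺ v<a)))

∈-aztecCells-odd : ∀ x u v {a b} → OnDiagonals (+ suc (u ℕ.+ u)) (+ suc (v ℕ.+ v)) x →
                   u < b → v ≤ a → x ∈ aztecCells a b
∈-aztecCells-odd x u v {a} {b} on u<b v≤a = subst (_∈ aztecCells a b)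
  (onDiagonals-unique (oddCell u v) x (σ-oddCell (+ u) (+ v) , δ-oddCell (+ u) (+ v)) on)
  (∈-++⁺ʳ (cartesianProductWith evenCell (upTo (suc b)) (upTo a))
    (∈-cartesianProductWith⁺ oddCell {upTo b} (∈-upTo⁺ u<b) (∈-upTo⁺ (ℕ.s≤s v≤a))))

aztecCells-≐ : ∀ a b → (λ x → x ∈ aztecCells a b) ≐ AztecRectangle a b
aztecCells-≐ a b = sound , complete
  where
  at : ∀ {σ δ s d : ℤ} → σ ≡ s → δ ≡ d →
    (0ℤ ℤ.≤ s × s ℤ.≤ + (2 * b)) × (1ℤ ℤ.≤ d × d ℤ.≤ + (2 * a ℕ.+ 1)) →
    (0ℤ ℤ.≤ σ × σ ℤ.≤ + (2 * b)) × (1ℤ ℤ.≤ δ × δ ℤ.≤ + (2 * a ℕ.+ 1))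
  at refl refl bounds = bounds

  odd-sum : ∀ u v → ¬ (2 ℕ.∣ (u ℕ.+ u) ℕ.+ suc (v ℕ.+ v))
  odd-sum u v 2∣ = from-no (2 ℕ.∣? 1) (ℕ.∣m+n∣m⇒∣n (subst (2 ℕ.∣_) (regroup u v) 2∣) (ℕ.m∣m*n (u ℕ.+ v)))
    where
    regroup : ∀ u v → (u ℕ.+ u) ℕ.+ suc (v ℕ.+ v) ≡ 2 * (u ℕ.+ v) ℕ.+ 1
    regroup = ℕ-Solver.solve-∀

  sound : ∀ {x} → x ∈ aztecCells a b → AztecRectangle a b x
  sound x∈ with ∈-++⁻ (cartesianProductWith evenCell (upTo (suc b)) (upTo a)) x∈
  ... | inj₁ x∈ₑ with ∈-cartesianProductWith⁻ evenCell (upTo (suc b)) (upTo a) x∈ₑ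
  ...   | u , v , u∈ , v∈ , refl = at (σ-evenCell (+ u) (+ suc v)) (δ-evenCell (+ u) (+ suc v))
    ((+≤+ ℕ.z≤n , +≤+ (n≤m⇒n+n≤2*m (ℕ.s≤s⁻¹ (∈-upTo⁻ u∈)))) ,
     (+≤+ (ℕ.s≤s ℕ.z≤n) , +≤+ (ℕ.≤-trans (n≤m⇒n+n≤2*m (∈-upTo⁻ v∈)) (ℕ.m≤m+n _ 1))))
  sound x∈ | inj₂ x∈ₒ with ∈-cartesianProductWith⁻ oddCell (upTo b) (upTo (suc a)) x∈ₒ
  ...   | u , v , u∈ , v∈ , refl = at (σ-oddCell (+ u) (+ v)) (δ-oddCell (+ u) (+ v))
    ((+≤+ ℕ.z≤n , +≤+ (n<m⇒n+n<2*m (∈-upTo⁻ u∈))) ,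
     (+≤+ (ℕ.s≤s ℕ.z≤n) , +≤+ (subst (suc (v ℕ.+ v) ℕ.≤_) (ℕ.+-comm 1 _)
        (ℕ.s≤s (n≤m⇒n+n≤2*m (ℕ.s≤s⁻¹ (∈-upTo⁻ v∈)))))))

  complete : ∀ {x} → AztecRectangle a b x → x ∈ aztecCells a b
  complete {x@(i , j)} ((0≤σ , σ≤) , (1≤δ , δ≤)) =
    cases (ℤ.∣ i ℤ.+ j ∣) (ℤ.∣ j ℤ.- i ∣)
      (sym (ℤ.0≤i⇒+∣i∣≡i 0≤σ)) (sym (ℤ.0≤i⇒+∣i∣≡i (ℤ.≤-trans (+≤+ ℕ.z≤n) 1≤δ)))
    where
    cases : ∀ m n → i ℤ.+ j ≡ + m → j ℤ.- i ≡ + n → x ∈ aztecCells a b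
    cases m n σ≡ δ≡ with parity m | parity n
    ... | inj₁ (u , refl) | inj₁ (zero , refl) =
      contradiction (subst (1ℤ ℤ.≤_) δ≡ 1≤δ) λ { (+≤+ ()) }
    ... | inj₁ (u , refl) | inj₁ (suc v , refl) = ∈-aztecCells-even x u v {a} {b} (σ≡ , δ≡)
      (n+n≤2*m⇒n≤m (ℤ.drop‿+≤+ (subst (ℤ._≤ _) σ≡ σ≤)))
      (n+n≤1+2*m⇒n≤m (ℤ.drop‿+≤+ (subst (ℤ._≤ _) δ≡ δ≤)))
    ... | inj₂ (u , refl) | inj₂ (v , refl) = ∈-aztecCells-odd x u v {a} {b} (σ≡ , δ≡)
      (n+n<2*m⇒n<m (ℤ.drop‿+≤+ (subst (ℤ._≤ _) σ≡ σ≤)))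
      (n+n≤1+2*m⇒n≤m (ℕ.≤-trans (ℕ.n≤1+n _) (ℤ.drop‿+≤+ (subst (ℤ._≤ _) δ≡ δ≤))))
    ... | inj₁ (u , refl) | inj₂ (v , refl) = contradiction
      (∣⇒∣ᵤ (onDiagonals⇒even x (σ≡ , δ≡))) (odd-sum u v)
    ... | inj₂ (u , refl) | inj₁ (v , refl) = contradiction
      (∣⇒∣ᵤ (onDiagonals⇒even x (σ≡ , δ≡)))
      (odd-sum v u ∘ subst (2 ℕ.∣_) (ℕ.+-comm (suc (u ℕ.+ u)) (v ℕ.+ v)))

-- A cover by n trominoes has 3n cells, while the number of cells modulo 3 depends only on the
-- residues `r` and `s`.
noCover : ∀ r s → ¬ (3 ℕ.∣ suc s * r ℕ.+ s * suc r) →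
          ∀ p q → ¬ HasCover (AztecRectangle (r ℕ.+ p * 3) (s ℕ.+ q * 3))
noCover r s 3∤ p q (ts , ts-covers) = 3∤ (ℕ.∣m+n∣m⇒∣n
  (ℕ.divides (length ts) (trans (sym (expand r s p q))
    (sym (trans (covers-length ts-covers (aztecCells-unique a b) (aztecCells-≐ a b))
      (length-aztecCells a b)))))
  (ℕ.m∣m*n (2 * (r * q ℕ.+ s * p ℕ.+ 3 * p * q) ℕ.+ p ℕ.+ q)))
  where
  a b : ℕ
  a = r ℕ.+ p * 3
  b = s ℕ.+ q * 3
  expand : ∀ r s p q → suc (s ℕ.+ q * 3) * (r ℕ.+ p * 3) ℕ.+ (s ℕ.+ q * 3) * suc (r ℕ.+ p * 3) ≡
    3 * (2 * (r * q ℕ.+ s * p ℕ.+ 3 * p * q) ℕ.+ p ℕ.+ q) ℕ.+ (suc s * r ℕ.+ s * suc r)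
  expand = ℕ-Solver.solve-∀

-- Covers of Aztec rectangles from a scheme

-- The half-open ends `2b + 1` and `1 + (2a + 1)` correspond to the closed ends `2b` and `2a + 1`.
-- The zero translation is that of the first copies.
aztec-box : ∀ r p q → Box 0ℤ 1ℤ (2 * r ℕ.+ 1 ℕ.+ q * 6) (2 * r ℕ.+ 1 ℕ.+ p * 6) ∘ unshift (0ℤ , 0ℤ)
            ≐ AztecRectangle (r ℕ.+ p * 3) (r ℕ.+ q * 3)
aztec-box r p q = subst₂ (λ w h → Box 0ℤ 1ℤ w h ∘ unshift (0ℤ , 0ℤ) ≐ AztecRectangle a b)
  (size r q) (size r p)
  ((λ {x} → ⇒ {x}) , (λ {x} → ⇐ {x}))
  where
  a b : ℕ
  a = r ℕ.+ p * 3
  b = r ℕ.+ q * 3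
  size : ∀ r q → suc (2 * (r ℕ.+ q * 3)) ≡ 2 * r ℕ.+ 1 ℕ.+ q * 6
  size = ℕ-Solver.solve-∀
  suc-≤ : ∀ {k n : ℤ} → n ℤ.< ℤ.suc k → n ℤ.≤ k
  suc-≤ {k} lt = subst (_ ℤ.≤_) (ℤ.pred-suc k) (ℤ.i<j⇒i≤pred[j] lt)
  ≤-suc : ∀ {k n : ℤ} → n ℤ.≤ k → n ℤ.< ℤ.suc k
  ≤-suc {k} le = ℤ.≤-<-trans le (ℤ.suc[i]≤j⇒i<j ℤ.≤-refl)
  ⇒ : ∀ {x} → Box 0ℤ 1ℤ (suc (2 * b)) (suc (2 * a)) (unshift (0ℤ , 0ℤ) x) → AztecRectangle a b x
  ⇒ {i , j} rewrite ℤ.+-identityʳ i | ℤ.+-identityʳ j = λ ((l , u) , (l′ , u′)) →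
    (l , suc-≤ u) , (l′ , suc-≤ (subst (λ n → j ℤ.- i ℤ.< + suc n) (ℕ.+-comm 1 _) u′))
  ⇐ : ∀ {x} → AztecRectangle a b x → Box 0ℤ 1ℤ (suc (2 * b)) (suc (2 * a)) (unshift (0ℤ , 0ℤ) x)
  ⇐ {i , j} rewrite ℤ.+-identityʳ i | ℤ.+-identityʳ j = λ ((l , u) , (l′ , u′)) →
    (l , ≤-suc u) , (l′ , subst (λ n → j ℤ.- i ℤ.< + suc n) (ℕ.+-comm _ 1) (≤-suc u′))

module _ (S : Scheme) where
  open Scheme S

  schemeCover : ℕ → ℕ → List LTromino
  schemeCover p q = row corner east q (0ℤ , 0ℤ) ++ repeat (row north tile q) _⟶north p (0ℤ , 0ℤ)

  schemeCover-covers : ∀ p q → schemeCover p q Covers AztecRectangle (r ℕ.+ p * 3) (r ℕ.+ q * 3)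
  schemeCover-covers p q = covers-resp-≐ (aztec-box r p q)
    (covers-above (0ℤ , 0ℤ) (row-covers corner-covers east-covers q (0ℤ , 0ℤ))
      (repeat-north-covers (row-covers north-covers tile-covers q) p (0ℤ , 0ℤ)))

-- Rules for termination, output and time

-- The output is exact but the time is only bounded, so branches of different length can share one
-- bound.
Terminates : Program → Memory → List ℤ → ℕ → (Memory → Set) → Set
Terminates p m out k Post =
  ∃[ m′ ] ∃[ t ] ⟨ p , m ⟩⇓⟨ m′ , out , t ⟩ × t ≤ k × Post m′

terminates-seq : ∀ {p q m out out′ k k′ Mid Post} → Terminates p m out k Mid →
  (∀ {m′} → Mid m′ → Terminates q m′ out′ k′ Post) →
  Terminates (p ⨾ q) m (out ++ out′) (k ℕ.+ k′) Post
terminates-seq (_ , _ , run , t≤ , mid) next with next mid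
... | _ , _ , run′ , t′≤ , post = _ , _ , seq run run′ , ℕ.+-mono-≤ t≤ t′≤ , post

terminates-instr : ∀ {ι q m m′ out out′ k Post} → ⟨ ι , m ⟩⟶⟨ m′ , out ⟩ →
  Terminates q m′ out′ k Post → Terminates (instr ι ⨾ q) m (out ++ out′) (suc k) Post
terminates-instr step (_ , _ , run , t≤ , post) = _ , _ , seq (instr step) run , ℕ.s≤s t≤ , post

terminates-weaken : ∀ {p m out k k′ Post Post′} → k ≤ k′ → (∀ {m′} → Post m′ → Post′ m′) →
  Terminates p m out k Post → Terminates p m out k′ Post′
terminates-weaken k≤k′ weaken (_ , _ , run , t≤ , post) =
  _ , _ , run , ℕ.≤-trans t≤ k≤k′ , weaken post

terminates-output : ∀ {p m out out′ k Post} → out ≡ out′ →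
  Terminates p m out k Post → Terminates p m out′ k Post
terminates-output {p} {m} {k = k} {Post} eq = subst (λ out → Terminates p m out k Post) eq

module _ {S : Set} (Inv : ℕ → S → Memory → Set) (next : S → S)
  (outs : ℕ → S → List ℤ) (emit : S → List ℤ)
  (outs-zero : ∀ s → [] ≡ outs 0 s)
  (outs-suc : ∀ n s → emit s ++ outs n (next s) ≡ outs (suc n) s)
  {r : Reg} {body : Program} {k : ℕ}
  (stop : ∀ {s m} → Inv 0 s m → m r ℤ.≤ 0ℤ)
  (go : ∀ {n s m} → Inv (suc n) s m → 0ℤ ℤ.< m r)
  (step : ∀ {n s m} → Inv (suc n) s m → Terminates body m (emit s) k (Inv n (next s)))
  where

  -- `n` rounds are left, `s` is the value tracked by the invariant and `outs n s` the output still
  -- to come. A round costs `k` and one test; the failing test costs 1.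
  terminates-while : ∀ n {s m} → Inv n s m →
    Terminates (while r >0-do body) m (outs n s) (suc (n * suc k)) (λ m′ → ∃[ s′ ] Inv 0 s′ m′)
  terminates-while zero {s} inv = _ , _ ,
    subst (λ out → ⟨ _ , _ ⟩⇓⟨ _ , out , _ ⟩) (outs-zero s) (while-false (stop inv)) ,
    ℕ.s≤s ℕ.z≤n , s , inv
  terminates-while (suc n) {s} inv with step inv
  ... | _ , _ , run , t≤ , inv′ with terminates-while n inv′
  ...   | _ , _ , run′ , t′≤ , post = terminates-output (outs-suc n s)
    (_ , _ , while-true (go inv) run run′ ,
     ℕ.s≤s (ℕ.≤-trans (ℕ.+-mono-≤ t≤ t′≤) (ℕ.≤-reflexive (ℕ.+-suc k (n * suc k)))) , post)

-- Programs that print a cover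

-- Registers used throughout: rA and rB hold first the input and then the code of
-- its residues; rP and rQ hold the quotients by 3, (rX , rY) the current
-- translation, (rX₀ , rY₀) the translation at the start of the current row, rN a
-- loop counter, and r3, r1, r0 constants.
rA rB rP rQ rX rY rT rN r3 r1 rX₀ rY₀ r0 : Reg
rA = 0
rB = 1
rP = 2
rQ = 3
rX = 4
rY = 5
rT = 6
rN = 7
r3 = 8
r1 = 9
rX₀ = 10
rY₀ = 11
r0 = 12

-- `null` serves for copying: the machine has no move instruction, so `r0` is added instead.
record Holds (p q : ℕ) (v₀ v : Cell) (m : Memory) : Set where
  constructor holds
  field
    P     : m rP ≡ + p
    Q     : m rQ ≡ + q
    X₀    : m rX₀ ≡ proj₁ v₀
    Y₀    : m rY₀ ≡ proj₂ v₀
    X     : m rX ≡ proj₁ v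
    Y     : m rY ≡ proj₂ v
    three : m r3 ≡ + 3
    one   : m r1 ≡ 1ℤ
    null  : m r0 ≡ 0ℤ

-- Stated with the boolean test of the memory update, so that at concrete registers the side
-- condition is `refl`.
_≈_off_ : Memory → Memory → Reg → Set
m′ ≈ m off r = ∀ s → (s ≡ᵇ r) ≡ false → m′ s ≡ m s


assign-off : ∀ {m m′ r v} → m′ ≈ m off r → (m′ [ r ↦ v ]) ≈ m off r
assign-off eq s s≢r rewrite s≢r = eq s s≢r

emitTromino : LTromino → Program
emitTromino (tromino (k , l) (d , e)) =
  instr (rT ≔ k) ⨾ instr (rT ≔ rX ⊕ rT) ⨾ instr (print rT) ⨾
  instr (rT ≔ l) ⨾ instr (rT ≔ rY ⊕ rT) ⨾ instr (print rT) ⨾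
  instr (rT ≔ (+ Fin.toℕ d)) ⨾ instr (print rT) ⨾
  instr (rT ≔ (+ Fin.toℕ e)) ⨾ instr (print rT)

emitTromino-terminates : ∀ t {v m} → m rX ≡ proj₁ v → m rY ≡ proj₂ v →
  Terminates (emitTromino t) m (encodeTromino (shift v t)) 10 (λ m′ → m′ ≈ m off rT)
emitTromino-terminates t {m = m} refl refl = _ , _ ,
  seq (instr const) (seq (instr add) (seq (instr print) (seq (instr const) (seq (instr add) (seq (instr print)
    (seq (instr const) (seq (instr print) (seq (instr const) (instr print))))))))) ,
  ℕ.≤-refl , assign-off (assign-off (assign-off (assign-off (assign-off (assign-off λ _ _ → refl)))))

emitAll : List LTromino → Program
emitAll []       = skip
emitAll (t ∷ ts) = emitTromino t ⨾ emitAll ts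

emitAllCost : List LTromino → ℕ
emitAllCost ts = length ts * 10 ℕ.+ 1

encodeAll : List LTromino → List ℤ
encodeAll = concatMap encodeTromino

emitAll-terminates : ∀ ts {v m} → m rX ≡ proj₁ v → m rY ≡ proj₂ v →
  Terminates (emitAll ts) m (encodeAll (map (shift v) ts)) (emitAllCost ts) (λ m′ → m′ ≈ m off rT)
emitAll-terminates []       x≡ y≡ = _ , _ , skip , ℕ.≤-refl , λ _ _ → refl
emitAll-terminates (t ∷ ts) x≡ y≡ = terminates-seq (emitTromino-terminates t x≡ y≡) λ unchanged →
  terminates-weaken ℕ.≤-refl (λ unchanged′ s s≢T → trans (unchanged′ s s≢T) (unchanged s s≢T))
    (emitAll-terminates ts (trans (unchanged rX refl) x≡) (trans (unchanged rY refl) y≡))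

holds-resp : ∀ {p q v₀ v m m′} → m′ ≈ m off rT → Holds p q v₀ v m → Holds p q v₀ v m′
holds-resp eq (holds P Q X₀ Y₀ X Y three one null) = holds
  (trans (eq rP refl) P) (trans (eq rQ refl) Q) (trans (eq rX₀ refl) X₀) (trans (eq rY₀ refl) Y₀)
  (trans (eq rX refl) X) (trans (eq rY refl) Y) (trans (eq r3 refl) three) (trans (eq r1 refl) one)
  (trans (eq r0 refl) null)

Counting : ℕ → (Memory → Set) → Memory → Set
Counting n Inv m = m rN ≡ + n × Inv m

≡suc⇒0< : ∀ {i n} → i ≡ + suc n → 0ℤ ℤ.< i
≡suc⇒0< refl = +<+ (ℕ.s≤s ℕ.z≤n)

stripLoop : List LTromino → Program
stripLoop ts = while rN >0-do
  (emitAll ts ⨾ instr (rX ≔ rX ⊕ r3) ⨾ instr (rY ≔ rY ⊕ r3) ⨾ instr (rN ≔ rN ⊖ r1))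

strip : List LTromino → ℕ → Cell → List LTromino
strip ts = repeat (λ v → map (shift v) ts) _⟶east

encodeAll-++ : ∀ ts us → encodeAll ts ++ encodeAll us ≡ encodeAll (ts ++ us)
encodeAll-++ ts us = sym (concatMap-++ encodeTromino ts us)

stripLoop-terminates : ∀ ts {p q v₀} n {v m} → Counting n (Holds p q v₀ v) m →
  Terminates (stripLoop ts) m (encodeAll (strip ts n v)) (suc (n * suc (emitAllCost ts ℕ.+ 3)))
    (λ m′ → ∃[ v′ ] Counting 0 (Holds p q v₀ v′) m′)
stripLoop-terminates ts {p} {q} {v₀} = terminates-while (λ n v → Counting n (Holds p q v₀ v)) _⟶east
  (λ n v → encodeAll (strip ts n v)) (λ v → encodeAll (map (shift v) ts))
  (λ _ → refl) (λ n v → encodeAll-++ (map (shift v) ts) (strip ts n (v ⟶east)))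
  (λ (N , _) → ℤ.≤-reflexive N) (λ (N , _) → ≡suc⇒0< N)
  λ {n} {v} (N , h) → terminates-output (++-identityʳ _)
    (terminates-seq (emitAll-terminates ts (Holds.X h) (Holds.Y h)) λ {m} unchanged →
      let holds P Q X₀ Y₀ X Y three one null = holds-resp unchanged h in
      _ , _ , seq (instr add) (seq (instr add) (instr sub)) , ℕ.≤-refl ,
      cong₂ ℤ._-_ (trans (unchanged rN refl) N) one ,
      holds P Q X₀ Y₀ (cong₂ ℤ._+_ X three) (cong₂ ℤ._+_ Y three) three one null)

rowProgram : List LTromino → List LTromino → Program
rowProgram first rest = emitAll first ⨾ instr (rN ≔ rQ ⊕ r0) ⨾ stripLoop rest

rowCost : List LTromino → List LTromino → ℕ → ℕ
rowCost first rest q = emitAllCost first ℕ.+ suc (suc (q * suc (emitAllCost rest ℕ.+ 3)))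

rowProgram-terminates : ∀ first rest {p q v₀ v m} → Holds p q v₀ v m →
  Terminates (rowProgram first rest) m (encodeAll (row first rest q v)) (rowCost first rest q)
    (λ m′ → ∃[ v′ ] Holds p q v₀ v′ m′)
rowProgram-terminates first rest {q = q} {v = v} h = terminates-output
  (encodeAll-++ (map (shift v) first) (strip rest q v))
  (terminates-seq (emitAll-terminates first (Holds.X h) (Holds.Y h)) λ unchanged →
    let h′@(holds P Q X₀ Y₀ X Y three one null) = holds-resp unchanged h in
    terminates-instr add (terminates-weaken ℕ.≤-refl (λ (v′ , _ , h″) → v′ , h″)
      (stripLoop-terminates rest q
        (trans (cong₂ ℤ._+_ Q null) (ℤ.+-identityʳ _) , holds P Q X₀ Y₀ X Y three one null))))

gridLoop : List LTromino → List LTromino → Program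
gridLoop first rest = while rP >0-do
  -- The start of this row is copied before `(rX₀ , rY₀)` moves on to the next one.
  (instr (rX ≔ rX₀ ⊕ r0) ⨾ instr (rY ≔ rY₀ ⊕ r0) ⨾
   instr (rX₀ ≔ rX₀ ⊖ r3) ⨾ instr (rY₀ ≔ rY₀ ⊕ r3) ⨾ instr (rP ≔ rP ⊖ r1) ⨾
   rowProgram first rest)

grid : List LTromino → List LTromino → ℕ → ℕ → Cell → List LTromino
grid first rest q = repeat (row first rest q) _⟶north

-- The current translation `v` is existential: a row leaves it at the end of its strip, and each
-- round reloads it from `v₀`.
gridLoop-terminates : ∀ first rest {q} p {v₀ m} → (∃[ v ] Holds p q v₀ v m) →
  Terminates (gridLoop first rest) m (encodeAll (grid first rest q p v₀))
    (suc (p * suc (5 ℕ.+ rowCost first rest q))) (λ m′ → ∃[ v₀′ ] ∃[ v ] Holds 0 q v₀′ v m′)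
gridLoop-terminates first rest {q} = terminates-while (λ p v₀ m → ∃[ v ] Holds p q v₀ v m) _⟶north
  (λ p v₀ → encodeAll (grid first rest q p v₀)) (λ v₀ → encodeAll (row first rest q v₀))
  (λ _ → refl) (λ p v₀ → encodeAll-++ (row first rest q v₀) (grid first rest q p (v₀ ⟶north)))
  (λ (_ , h) → ℤ.≤-reflexive (Holds.P h)) (λ (_ , h) → ≡suc⇒0< (Holds.P h))
  λ {p} {v₀} (_ , holds P Q X₀ Y₀ X Y three one null) →
    terminates-instr add (terminates-instr add (terminates-instr sub (terminates-instr add (terminates-instr sub
      (rowProgram-terminates first rest (holds
        (cong₂ ℤ._-_ P one) Q (cong₂ ℤ._-_ X₀ three) (cong₂ ℤ._+_ Y₀ three)
        (trans (cong₂ ℤ._+_ X₀ null) (ℤ.+-identityʳ _)) (trans (cong₂ ℤ._+_ Y₀ null) (ℤ.+-identityʳ _))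
        three one null))))))

module _ (S : Scheme) where
  open Scheme S

  -- `r1` supplies the leading 1 of the encoded answer. The grid also starts at translation zero, as
  -- the `north` piece already lies above the corner.
  coverProgram : Program
  coverProgram = instr (print r1) ⨾ rowProgram corner east ⨾ gridLoop north tile

  coverCost : ℕ → ℕ → ℕ
  coverCost p q = suc (rowCost corner east q ℕ.+ suc (p * suc (5 ℕ.+ rowCost north tile q)))

  coverProgram-terminates : ∀ {p q m} → Holds p q (0ℤ , 0ℤ) (0ℤ , 0ℤ) m →
    Terminates coverProgram m (encode (just (schemeCover S p q))) (coverCost p q) (λ _ → ⊤)
  coverProgram-terminates {p} {q} h = terminates-output
    (cong₂ _∷_ (Holds.one h) (encodeAll-++ (row corner east q _) _))
    (terminates-instr print (terminates-seq (rowProgram-terminates corner east h)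
      λ (v , h′) → terminates-weaken ℕ.≤-refl (λ _ → tt) (gridLoop-terminates north tile p (v , h′))))

-- Division by 3 by repeated subtraction

-- Only positivity can be tested. The subtraction in advance turns the test into "more than 3 is
-- left", which yields remainders 1, 2, 3 instead of 0, 1, 2.
quotient : Program
quotient = instr (rT ≔ rT ⊖ r3) ⨾ instr (rN ≔ 0ℤ) ⨾
  while rT >0-do (instr (rT ≔ rT ⊖ r3) ⨾ instr (rN ≔ rN ⊕ r1))

-- `n` rounds are left and `k` are done. `rT` is one subtraction ahead and ends as -2, -1 or 0.
record Dividing (m₀ : Memory) (ρ : Fin 3) (n k : ℕ) (m : Memory) : Set where
  constructor dividing
  field
    T         : m rT ≡ + (suc (Fin.toℕ ρ) ℕ.+ n * 3) ℤ.- + 3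
    N         : m rN ≡ + k
    unchanged : ∀ s → (s ≡ᵇ rT) ≡ false → (s ≡ᵇ rN) ≡ false → m s ≡ m₀ s

quotient-terminates : ∀ (ρ : Fin 3) n {m} → m rT ≡ + (suc (Fin.toℕ ρ) ℕ.+ n * 3) →
  m r3 ≡ + 3 → m r1 ≡ 1ℤ → Terminates quotient m [] (3 ℕ.+ n * 3) (Dividing m ρ 0 n)
quotient-terminates ρ n {m} T three one = terminates-instr sub (terminates-instr const
  (terminates-weaken ℕ.≤-refl
    (λ { (k , k≡n , d) → subst (λ k → Dividing m ρ 0 k _) (trans (sym (ℕ.+-identityʳ k)) k≡n) d })
    -- The loop rule leaves the final count existential; the equation identifies it as `n`.
    (terminates-while (λ j k m′ → k ℕ.+ j ≡ n × Dividing m ρ j k m′) suc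
      (λ _ _ → []) (λ _ → []) (λ _ → refl) (λ _ _ → refl)
      (λ { (_ , d) → stop ρ (Dividing.T d) }) (λ { {j} (_ , d) → go ρ j (Dividing.T d) })
      (λ { {j} {k} {m′} (k+j≡n , dividing T N unchanged) →
        let three′ = trans (unchanged r3 refl refl) three
            one′   = trans (unchanged r1 refl refl) one
        in _ , _ , seq (instr sub) (instr add) , ℕ.≤-refl ,
        trans (sym (ℕ.+-suc k j)) k+j≡n ,
        dividing (trans (cong₂ ℤ._-_ T three′) (decrease (+ suc (Fin.toℕ ρ)) (+ (j * 3))))
          (trans (cong₂ ℤ._+_ N one′) (cong +_ (ℕ.+-comm k 1)))
          (off m m′ unchanged) })
      n (refl , dividing (cong₂ ℤ._-_ T three) refl (off m m λ _ _ _ → refl)))))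
  where
  off : ∀ m m′ {u w} →
    (∀ s → (s ≡ᵇ rT) ≡ false → (s ≡ᵇ rN) ≡ false → m′ s ≡ m s) →
    ∀ s → (s ≡ᵇ rT) ≡ false → (s ≡ᵇ rN) ≡ false → ((m′ [ rT ↦ u ]) [ rN ↦ w ]) s ≡ m s
  off m m′ eq s s≢T s≢N rewrite s≢N | s≢T = eq s s≢T s≢N
  decrease : ∀ r k → ((r ℤ.+ (+ 3 ℤ.+ k)) ℤ.- + 3) ℤ.- + 3 ≡ (r ℤ.+ k) ℤ.- + 3
  decrease = solve-∀
  stop : ∀ {i} (ρ : Fin 3) → i ≡ + (suc (Fin.toℕ ρ) ℕ.+ 0) ℤ.- + 3 → i ℤ.≤ 0ℤ
  stop 0F refl = ℤ.-≤+
  stop 1F refl = ℤ.-≤+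
  stop 2F refl = +≤+ ℕ.z≤n
  go : ∀ {i} (ρ : Fin 3) j → i ≡ + (suc (Fin.toℕ ρ) ℕ.+ suc j * 3) ℤ.- + 3 → 0ℤ ℤ.< i
  go 0F j refl = +<+ (ℕ.s≤s ℕ.z≤n)
  go 1F j refl = +<+ (ℕ.s≤s ℕ.z≤n)
  go 2F j refl = +<+ (ℕ.s≤s ℕ.z≤n)

setup : Program → Program
setup next =
  instr (r3 ≔ (+ 3)) ⨾ instr (r1 ≔ 1ℤ) ⨾
  instr (rT ≔ rA ⊕ r0) ⨾ quotient ⨾ instr (rA ≔ rT ⊕ r1) ⨾ instr (rP ≔ rN ⊕ r0) ⨾
  instr (rT ≔ rB ⊕ r0) ⨾ quotient ⨾ instr (rB ≔ rT ⊕ r1) ⨾ instr (rQ ≔ rN ⊕ r0) ⨾ next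

-- The remainder in {1, 2, 3} is stored minus 2, so that tests for positivity tell
-- the three cases apart.
residue : Fin 3 → ℤ
residue ρ = (+ (suc (Fin.toℕ ρ) ℕ.+ 0) ℤ.- + 3) ℤ.+ 1ℤ

-- The translation registers and `r0` are not assigned, so they keep the 0 of the initial memory.
setup-terminates : ∀ {next} (ρ ρ′ : Fin 3) p q {out k Post} →
  (∀ {m} → m rA ≡ residue ρ → m rB ≡ residue ρ′ → Holds p q (0ℤ , 0ℤ) (0ℤ , 0ℤ) m →
    Terminates next m out k Post) →
  Terminates (setup next) (input (suc (Fin.toℕ ρ) ℕ.+ p * 3) (suc (Fin.toℕ ρ′) ℕ.+ q * 3)) out
    (3 ℕ.+ ((3 ℕ.+ p * 3) ℕ.+ (3 ℕ.+ ((3 ℕ.+ q * 3) ℕ.+ (2 ℕ.+ k))))) Post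
setup-terminates ρ ρ′ p q next = terminates-instr const (terminates-instr const (terminates-instr add
  (terminates-seq (quotient-terminates ρ p (cong +_ (ℕ.+-identityʳ _)) refl refl) λ (dividing T N eq) →
    terminates-instr add (terminates-instr add (terminates-instr add
      (terminates-seq (quotient-terminates ρ′ q
        (trans (cong₂ ℤ._+_ (eq rB refl refl) (eq r0 refl refl)) (cong +_ (ℕ.+-identityʳ _)))
        (eq r3 refl refl) (eq r1 refl refl)) λ (dividing T′ N′ eq′) →
        terminates-instr add (terminates-instr add (next
          (trans (eq′ rA refl refl) (cong₂ ℤ._+_ T (eq r1 refl refl)))
          (cong₂ ℤ._+_ T′ (trans (eq′ r1 refl refl) (eq r1 refl refl)))
          (holds
            (trans (eq′ rP refl refl) (trans (cong₂ ℤ._+_ N (eq r0 refl refl)) (ℤ.+-identityʳ _)))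
            (trans (cong₂ ℤ._+_ N′ (trans (eq′ r0 refl refl) (eq r0 refl refl))) (ℤ.+-identityʳ _))
            (trans (eq′ rX₀ refl refl) (eq rX₀ refl refl))
            (trans (eq′ rY₀ refl refl) (eq rY₀ refl refl))
            (trans (eq′ rX refl refl) (eq rX refl refl))
            (trans (eq′ rY refl refl) (eq rY refl refl))
            (trans (eq′ r3 refl refl) (eq r3 refl refl))
            (trans (eq′ r1 refl refl) (eq r1 refl refl))
            (trans (eq′ r0 refl refl) (eq r0 refl refl)))))))))))

-- Selection by residues and the whole program

branch : Reg → (Fin 3 → Program) → Program
branch r select = if r >0-then select 2F else
  (instr (r ≔ r ⊕ r1) ⨾ if r >0-then select 1F else select 0F)

≡ᵇ-refl : ∀ n → (n ≡ᵇ n) ≡ true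
≡ᵇ-refl zero    = refl
≡ᵇ-refl (suc n) = ≡ᵇ-refl n

update-same : ∀ m r v → (m [ r ↦ v ]) r ≡ v
update-same m r v rewrite ≡ᵇ-refl r = refl

branch-terminates : ∀ r select (ρ : Fin 3) {m out k Post} → m r ≡ residue ρ → m r1 ≡ 1ℤ →
  (∀ {m′} → m′ ≈ m off r → Terminates (select ρ) m′ out k Post) →
  Terminates (branch r select) m out (3 ℕ.+ k) Post
branch-terminates r select 2F {m} R one next with next {m} (λ _ _ → refl)
... | _ , _ , run , t≤ , post =
  _ , _ , if-true (≡suc⇒0< R) run , ℕ.s≤s (ℕ.≤-trans t≤ (ℕ.m≤n+m _ 2)) , post
branch-terminates r select 1F {m} R one next with next (assign-off λ _ _ → refl)
... | _ , _ , run , t≤ , post = _ , _ ,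
  if-false (ℤ.≤-reflexive R) (seq (instr add) (if-true
    (≡suc⇒0< (trans (update-same m r _) (cong₂ ℤ._+_ R one))) run)) ,
  ℕ.s≤s (ℕ.s≤s (ℕ.s≤s t≤)) , post
branch-terminates r select 0F {m} R one next with next (assign-off λ _ _ → refl)
... | _ , _ , run , t≤ , post = _ , _ ,
  if-false (ℤ.≤-trans (ℤ.≤-reflexive R) ℤ.-≤+) (seq (instr add) (if-false
    (ℤ.≤-reflexive (trans (update-same m r _) (cong₂ ℤ._+_ R one))) run)) ,
  ℕ.s≤s (ℕ.s≤s (ℕ.s≤s t≤)) , post

-- `0F`, `1F`, `2F` stand for remainders 1, 2, 3. In the remaining seven cases the number of cells
-- is not divisible by 3, and the 0 in `r0` encodes the refusal.
answer : Fin 3 → Fin 3 → Program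
answer 1F 1F = coverProgram scheme₂
answer 2F 2F = coverProgram scheme₃
answer _  _  = instr (print r0)

program : Program
program = setup (branch rA λ ρ → branch rB (answer ρ))

-- Time bounds and correctness of the answers

rowFactor : List LTromino → List LTromino → ℕ
rowFactor first rest = (emitAllCost first ℕ.+ 2) ℕ.+ suc (emitAllCost rest ℕ.+ 3)

-- Affine costs become multiples of `suc n`, so the bounds of nested loops multiply to a multiple of
-- `suc p * suc q`.
affine-≤ : ∀ c d n → c ℕ.+ n * d ≤ (c ℕ.+ d) * suc n
affine-≤ c d n = subst (c ℕ.+ n * d ≤_) (expand c d n) (ℕ.m≤m+n _ (d ℕ.+ n * c))
  where
  expand : ∀ c d n → (c ℕ.+ n * d) ℕ.+ (d ℕ.+ n * c) ≡ (c ℕ.+ d) * suc n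
  expand = ℕ-Solver.solve-∀

rowCost-≤ : ∀ first rest q → rowCost first rest q ≤ rowFactor first rest * suc q
rowCost-≤ first rest q = subst (_≤ rowFactor first rest * suc q)
  (ℕ.+-assoc (emitAllCost first) 2 _) (affine-≤ (emitAllCost first ℕ.+ 2) _ q)

module _ (S : Scheme) where
  open Scheme S

  coverFactor : ℕ
  coverFactor = (2 ℕ.+ rowFactor corner east) ℕ.+ (6 ℕ.+ rowFactor north tile)

  coverCost-≤ : ∀ p q → coverCost S p q ≤ coverFactor * (suc p * suc q)
  coverCost-≤ p q = begin
    suc (rowCost corner east q ℕ.+ suc (p * suc (5 ℕ.+ rowCost north tile q)))
      ≡⟨ cong suc (ℕ.+-suc (rowCost corner east q) _) ⟩
    (2 ℕ.+ rowCost corner east q) ℕ.+ p * (6 ℕ.+ rowCost north tile q)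
      ≤⟨ ℕ.+-mono-≤ (scale 2 κ₁ (rowCost-≤ corner east q))
           (ℕ.*-monoʳ-≤ p (scale 6 κ₂ (rowCost-≤ north tile q))) ⟩
    (2 ℕ.+ κ₁) * suc q ℕ.+ p * ((6 ℕ.+ κ₂) * suc q)
      ≤⟨ affine-≤ _ _ p ⟩
    ((2 ℕ.+ κ₁) * suc q ℕ.+ (6 ℕ.+ κ₂) * suc q) * suc p
      ≡⟨ regroup (2 ℕ.+ κ₁) (6 ℕ.+ κ₂) (suc p) (suc q) ⟩
    coverFactor * (suc p * suc q) ∎
    where
    open ℕ.≤-Reasoning
    κ₁ κ₂ : ℕ
    κ₁ = rowFactor corner east
    κ₂ = rowFactor north tile
    scale : ∀ c κ {k} → k ≤ κ * suc q → c ℕ.+ k ≤ (c ℕ.+ κ) * suc q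
    scale c κ k≤ = ℕ.≤-trans (ℕ.+-mono-≤ (ℕ.m≤m*n c (suc q)) k≤)
      (ℕ.≤-reflexive (sym (ℕ.*-distribʳ-+ (suc q) c κ)))
    regroup : ∀ c d P Q → (c * Q ℕ.+ d * Q) * P ≡ (c ℕ.+ d) * (P * Q)
    regroup = ℕ-Solver.solve-∀

answerFactor : ℕ
answerFactor = 1 ℕ.+ (coverFactor scheme₂ ℕ.+ coverFactor scheme₃)

totalFactor : ℕ
totalFactor = 26 ℕ.+ answerFactor

answer-terminates : ∀ ρ ρ′ p q → Σ[ ans ∈ Answer ]
  (∀ {m} → Holds p q (0ℤ , 0ℤ) (0ℤ , 0ℤ) m →
    Terminates (answer ρ ρ′) m (encode ans) (answerFactor * (suc p * suc q)) (λ _ → ⊤)) ×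
  Correct (AztecRectangle (suc (Fin.toℕ ρ) ℕ.+ p * 3) (suc (Fin.toℕ ρ′) ℕ.+ q * 3)) ans
answer-terminates = cases
  where
  -- The program is a parameter because `answer ρ ρ′` reduces only at concrete residues; thus one
  -- rejection argument serves all seven pairs.
  Result : Program → Fin 3 → Fin 3 → ℕ → ℕ → Set
  Result prog ρ ρ′ p q = Σ[ ans ∈ Answer ]
    (∀ {m} → Holds p q (0ℤ , 0ℤ) (0ℤ , 0ℤ) m →
      Terminates prog m (encode ans) (answerFactor * (suc p * suc q)) (λ _ → ⊤)) ×
    Correct (AztecRectangle (suc (Fin.toℕ ρ) ℕ.+ p * 3) (suc (Fin.toℕ ρ′) ℕ.+ q * 3)) ans

  reject : ∀ ρ ρ′ → let r = suc (Fin.toℕ ρ); s = suc (Fin.toℕ ρ′) in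
    {False (3 ℕ.∣? (suc s * r ℕ.+ s * suc r))} → ∀ p q → Result (instr (print r0)) ρ ρ′ p q
  reject ρ ρ′ {3∤} p q = nothing ,
    (λ h → terminates-output (cong [_] (Holds.null h)) (_ , _ , instr print , ℕ.s≤s ℕ.z≤n , tt)) ,
    noCover (suc (Fin.toℕ ρ)) (suc (Fin.toℕ ρ′)) (toWitnessFalse 3∤) p q

  accept : ∀ S {ρ} → Scheme.r S ≡ suc (Fin.toℕ ρ) → coverFactor S ≤ answerFactor →
    ∀ p q → Result (coverProgram S) ρ ρ p q
  accept S r≡ factor≤ p q = just (schemeCover S p q) ,
    (λ h → terminates-weaken
      (ℕ.≤-trans (coverCost-≤ S p q) (ℕ.*-monoˡ-≤ (suc p * suc q) factor≤)) id
      (coverProgram-terminates S h)) ,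
    subst (λ r → schemeCover S p q Covers AztecRectangle (r ℕ.+ p * 3) (r ℕ.+ q * 3)) r≡
      (schemeCover-covers S p q)

  cases : ∀ ρ ρ′ p q → Result (answer ρ ρ′) ρ ρ′ p q
  cases 0F 0F = reject 0F 0F
  cases 0F 1F = reject 0F 1F
  cases 0F 2F = reject 0F 2F
  cases 1F 0F = reject 1F 0F
  cases 1F 1F = accept scheme₂ refl (ℕ.≤-trans (ℕ.m≤m+n _ (coverFactor scheme₃)) (ℕ.n≤1+n _))
  cases 1F 2F = reject 1F 2F
  cases 2F 0F = reject 2F 0F
  cases 2F 1F = reject 2F 1F
  cases 2F 2F = accept scheme₃ refl (ℕ.≤-trans (ℕ.m≤n+m _ (coverFactor scheme₂)) (ℕ.n≤1+n _))

-- The 20 consists of 14 steps for the setup and 3 for each of the two branchings.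
program-terminates : ∀ ρ ρ′ p q {out k Post} →
  (∀ {m} → Holds p q (0ℤ , 0ℤ) (0ℤ , 0ℤ) m → Terminates (answer ρ ρ′) m out k Post) →
  Terminates program (input (suc (Fin.toℕ ρ) ℕ.+ p * 3) (suc (Fin.toℕ ρ′) ℕ.+ q * 3)) out
    (20 ℕ.+ p * 3 ℕ.+ q * 3 ℕ.+ k) Post
program-terminates ρ ρ′ p q {k = k} next = terminates-weaken (ℕ.≤-reflexive (regroup (p * 3) (q * 3) k)) id
  (setup-terminates ρ ρ′ p q λ A B h →
    branch-terminates rA (λ ρ → branch rB (answer ρ)) ρ A (Holds.one h) λ off →
      branch-terminates rB (answer ρ) ρ′ (trans (off rB refl) B) (trans (off r1 refl) (Holds.one h)) λ off′ →
        next (unaffected off off′ h))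
  where
  regroup : ∀ p q k → 3 ℕ.+ ((3 ℕ.+ p) ℕ.+ (3 ℕ.+ ((3 ℕ.+ q) ℕ.+ (2 ℕ.+ (3 ℕ.+ (3 ℕ.+ k)))))) ≡
    20 ℕ.+ p ℕ.+ q ℕ.+ k
  regroup = ℕ-Solver.solve-∀
  unaffected : ∀ {p q v₀ v m m′ m″} → m′ ≈ m off rA → m″ ≈ m′ off rB →
               Holds p q v₀ v m → Holds p q v₀ v m″
  unaffected {m = m} {m″ = m″} off off′ (holds P Q X₀ Y₀ X Y three one null) = holds
    -- The numerals are register numbers minus 2: only `rA` and `rB`, registers 0 and 1, have
    -- changed.
    (eq 0 P) (eq 1 Q) (eq 8 X₀) (eq 9 Y₀) (eq 2 X) (eq 3 Y) (eq 6 three) (eq 7 one) (eq 10 null)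
    where
    eq : ∀ s {i} → m (2 ℕ.+ s) ≡ i → m″ (2 ℕ.+ s) ≡ i
    eq s m≡ = trans (off′ (2 ℕ.+ s) refl) (trans (off (2 ℕ.+ s) refl) m≡)

-- The quadratic bound

-- Dividing `n - 1` gives the remainders 1, 2, 3 that `quotient` produces.
divide-by-3 : ∀ {n} → 1 ≤ n → Σ[ ρ ∈ Fin 3 ] Σ[ k ∈ ℕ ] n ≡ suc (Fin.toℕ ρ) ℕ.+ k * 3
divide-by-3 {suc n} _ with n divMod 3
... | result k ρ n≡ = ρ , k , cong suc n≡

-- 26 is the sum of the coefficients 20 + 3 + 3.
overhead-≤ : ∀ p q → 20 ℕ.+ p * 3 ℕ.+ q * 3 ≤ 26 * (suc p * suc q)
overhead-≤ p q = subst (20 ℕ.+ p * 3 ℕ.+ q * 3 ≤_) (expand p q) (ℕ.m≤m+n _ _)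
  where
  expand : ∀ p q → (20 ℕ.+ p * 3 ℕ.+ q * 3) ℕ.+ (6 ℕ.+ 23 * p ℕ.+ 23 * q ℕ.+ 26 * (p * q)) ≡
    26 * (suc p * suc q)
  expand = ℕ-Solver.solve-∀

theorem8 : Σ[ p ∈ Program ] Σ[ C ∈ ℕ ] ((a b : ℕ) → 1 ≤ a → a ≤ b →
    Σ[ ans ∈ Answer ] Σ[ t ∈ ℕ ]
    (p on input a b Prints encode ans In t Steps) ×
    Correct (AztecRectangle a b) ans ×
    t ≤ C * b ^ 2)
theorem8 = program , totalFactor , solve
  where
  Solved : ℕ → ℕ → Set
  Solved a b = Σ[ ans ∈ Answer ] Σ[ t ∈ ℕ ]
    (program on input a b Prints encode ans In t Steps) ×
    Correct (AztecRectangle a b) ans × t ≤ totalFactor * b ^ 2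

  within : ∀ {p q b t} → suc p ≤ b → suc q ≤ b →
    t ≤ 20 ℕ.+ p * 3 ℕ.+ q * 3 ℕ.+ answerFactor * (suc p * suc q) → t ≤ totalFactor * b ^ 2
  within {p} {q} {b} {t} p<b q<b t≤ = begin
    t
      ≤⟨ t≤ ⟩
    20 ℕ.+ p * 3 ℕ.+ q * 3 ℕ.+ answerFactor * (suc p * suc q)
      ≤⟨ ℕ.+-monoˡ-≤ _ (overhead-≤ p q) ⟩
    26 * (suc p * suc q) ℕ.+ answerFactor * (suc p * suc q)
      ≡⟨ ℕ.*-distribʳ-+ (suc p * suc q) 26 answerFactor ⟨
    totalFactor * (suc p * suc q)
      ≤⟨ ℕ.*-monoʳ-≤ totalFactor (ℕ.*-mono-≤ p<b q<b) ⟩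
    totalFactor * (b * b)
      ≡⟨ cong (λ n → totalFactor * (b * n)) (ℕ.*-identityʳ b) ⟨
    totalFactor * b ^ 2 ∎
    where open ℕ.≤-Reasoning

  quotient< : ∀ (ρ : Fin 3) k → suc k ≤ suc (Fin.toℕ ρ) ℕ.+ k * 3
  quotient< ρ k = ℕ.s≤s (ℕ.≤-trans (ℕ.m≤m*n k 3) (ℕ.m≤n+m (k * 3) (Fin.toℕ ρ)))

  solve : (a b : ℕ) → 1 ≤ a → a ≤ b → Solved a b
  solve a b 1≤a a≤b =
    let ρ  , p , a≡ = divide-by-3 1≤a
        ρ′ , q , b≡ = divide-by-3 (ℕ.≤-trans 1≤a a≤b)
        ans , run-answer , correct = answer-terminates ρ ρ′ p q
        m , t , run , t≤ , _ = program-terminates ρ ρ′ p q run-answer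
        -- `a ≤ b` bounds `suc p` by `b` too, so that `suc p * suc q` is at most `b * b`.
        p<b = ℕ.≤-trans (quotient< ρ p) (subst₂ _≤_ a≡ b≡ a≤b)
    in subst₂ Solved (sym a≡) (sym b≡)
      (ans , t , (m , run) , correct , within p<b (quotient< ρ′ q) t≤)
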